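{- Let $\lambda\in\mathbb{R}\setminus\{0\}$, $k\in\mathbb{Z}$, $u\in\mathbb{C}$ with $u\neq 1$, and $x\in\mathbb{R}$. Then for every integer $n\geq 0$, \[ \sum_{m=0}^{n}\binom{n}{m}FG_{m,\lambda}^{(k)}(x,u)\,(1)_{n-m,\lambda}-u\,FG_{n,\lambda}^{(k)}(x,u) =(1-u)\,n\sum_{m=0}^{n-1}\frac{\binom{n-1}{m}}{m+1}\sum_{j=1}^{m+1}\frac{(1)_{j,\lambda}}{j^{k-1}}S_{1,\lambda}(m+1,j)\,(x)_{n-1-m,\lambda}. \]
   Context: All generating functions are formal power series in $t$. For $z\in\mathbb{C}$: $(z)_{0,\lambda}=1$ and $(z)_{n,\lambda}=z(z-\lambda)\cdots(z-(n-1)\lambda)$ for $n\ge1$. The degenerate exponential is $e_\lambda^{z}(t)=(1+\lambda t)^{z/\lambda}=\sum_{n\ge0}(z)_{n,\lambda}\frac{t^n}{n!}$, and $e_\lambda(t)=e_\lambda^{1}(t)$. Also $\log_\lambda(1+t)=\frac{1}{\lambda}\big((1+t)^\lambda-1\big)$. The degenerate Stirling numbers of the first kind are defined by $\frac{1}{j!}(\log_\lambda(1+t))^j=\sum_{n\ge j}S_{1,\lambda}(n,j)\frac{t^n}{n!}$. The modified degenerate polyexponential function is $\mathrm{Ei}_{k,\lambda}(x)=\sum_{n\ge1}\frac{(1)_{n,\lambda}}{n^k(n-1)!}x^n$. The degenerate poly-Frobenius-Genocchi polynomials are defined by $\sum_{n\ge0}FG_{n,\lambda}^{(k)}(x,u)\frac{t^n}{n!}=\frac{(1-u)\,\mathrm{Ei}_{k,\lambda}(\log_\lambda(1+t))}{e_\lambda(t)-u}e_\lambda^{x}(t)$.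 -}

module Defs where

open import Algebra.Apartness.Bundles using (HeytingCommutativeRing; HeytingField)
open import Algebra.Bundles using (CommutativeRing; Semiring)
open import Algebra.Core using (Op₁; Op₂)
open import Algebra.Definitions using (Invertible)
open import Algebra.Structures using (IsCommutativeRing)
open import Data.Empty using (⊥-elim)
open import Data.Fin.Base using (toℕ)
open import Data.Nat.Base as ℕ using (ℕ; zero; suc; _∸_; _!)
import Data.Nat.Properties as ℕ
open import Data.Nat.Properties using (_!≢0)
open import Data.Product.Base using (∃-syntax; _×_; _,_; proj₁; proj₂)
open import Data.Rational.Base as ℚ using (ℚ; 0ℚ; 1ℚ; ½; ∣_∣; 1/_)
import Data.Rational.Properties as ℚ
open import Data.Rational.Solver using (module +-*-Solver)
open import Data.Sum.Base using (_⊎_; inj₁; inj₂; [_,_]′)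
open import Level using (Level; 0ℓ)
open import Relation.Binary.Bundles using (Setoid)
open import Relation.Binary.Core using (Rel)
open import Relation.Binary.Structures using (IsEquivalence)
open import Relation.Nullary using (¬_; yes; no)

module _ {R : Set} {_≈_ : Rel R 0ℓ} (isEquivalence : IsEquivalence _≈_)
         {_+_ _*_ : Op₂ R} { -_ : Op₁ R} {0# 1# : R} where
  private
    setoid : Setoid 0ℓ 0ℓ
    setoid = record { isEquivalence = isEquivalence }
  open import Algebra.Consequences.Setoid setoid
  open import Algebra.Definitions _≈_

  mkCommutativeRing :
    Congruent₂ _+_ → Congruent₂ _*_ → Congruent₁ -_ →
    Associative _+_ → Commutative _+_ → LeftIdentity 0# _+_ → LeftInverse 0# -_ _+_ →
    Associative _*_ → Commutative _*_ → LeftIdentity 1# _*_ → _*_ DistributesOverˡ _+_ →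
    IsCommutativeRing _≈_ _+_ _*_ -_ 0# 1#
  mkCommutativeRing +-cong *-cong -‿cong +-assoc +-comm +-idˡ +-invˡ *-assoc *-comm *-idˡ distribˡ =
    record
    { isRing = record
      { +-isAbelianGroup = record
        { isGroup = record
          { isMonoid = record
            { isSemigroup = record
              { isMagma = record { isEquivalence = isEquivalence ; ∙-cong = +-cong }
              ; assoc = +-assoc }
            ; identity = comm∧idˡ⇒id +-comm +-idˡ }
          ; inverse = comm∧invˡ⇒inv +-comm +-invˡ
          ; ⁻¹-cong = -‿cong }
        ; comm = +-comm }
      ; *-cong = *-cong
      ; *-assoc = *-assoc
      ; *-identity = comm∧idˡ⇒id *-comm *-idˡ
      ; distrib = comm∧distrˡ⇒distr +-cong *-comm distribˡ }
    ; *-comm = *-comm }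

-- The field in which x # y is (x - y) #0.
module _ (R : CommutativeRing 0ℓ 0ℓ) (_#0 : CommutativeRing.Carrier R → Set) where
  open CommutativeRing R renaming (Carrier to A)
  open import Algebra.Properties.Ring ring using (-‿distribˡ-*; -‿distribʳ-*; -‿involutive; -‿+-comm)
  open import Relation.Binary.Reasoning.Setoid setoid

  mkHeytingField :
    (∀ {x y} → x ≈ y → x #0 → y #0) →
    (∀ {x y} → (x + y) #0 → x #0 ⊎ y #0) →
    (∀ {x} → ¬ (x #0) → x ≈ 0#) →
    ¬ (0# #0) →
    (∀ {x} → x #0 → Invertible _≈_ 1# _*_ x) →
    (∀ {x} → Invertible _≈_ 1# _*_ x → x #0) →
    HeytingField 0ℓ 0ℓ 0ℓ
  mkHeytingField resp split tight₀ irrefl₀ inv inv⁻¹ = record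
    { Carrier = A ; _≈_ = _≈_ ; _#_ = λ x y → (x - y) #0
    ; _+_ = _+_ ; _*_ = _*_ ; -_ = -_ ; 0# = 0# ; 1# = 1#
    ; isHeytingField = record
      { isHeytingCommutativeRing = record
        { isCommutativeRing = isCommutativeRing
        ; isApartnessRelation = record { irrefl = irrefl′ ; sym = sym′ ; cotrans = cotrans′ }
        ; #⇒invertible = inv
        ; invertible⇒# = inv⁻¹ }
      ; tight = λ x y → (λ ¬x#y → x-y≈0⇒x≈y x y (tight₀ ¬x#y)) , irrefl′ } }
    where
    x≈y⇒x-y≈0 : ∀ {x y} → x ≈ y → x - y ≈ 0#
    x≈y⇒x-y≈0 {x} {y} x≈y = trans (+-congʳ x≈y) (-‿inverseʳ y)

    x-y+y≈x : ∀ x y → (x - y) + y ≈ x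
    x-y+y≈x x y = trans (+-assoc x (- y) y) (trans (+-congˡ (-‿inverseˡ y)) (+-identityʳ x))

    x-y≈0⇒x≈y : ∀ x y → x - y ≈ 0# → x ≈ y
    x-y≈0⇒x≈y x y eq = trans (sym (x-y+y≈x x y)) (trans (+-congʳ eq) (+-identityˡ y))

    irrefl′ : ∀ {x y} → x ≈ y → ¬ ((x - y) #0)
    irrefl′ x≈y x#y = irrefl₀ (resp (x≈y⇒x-y≈0 x≈y) x#y)

    neg-invertible : ∀ {x} → Invertible _≈_ 1# _*_ x → Invertible _≈_ 1# _*_ (- x)
    neg-invertible {x} (y , yx , xy) = - y , neg*neg yx , neg*neg xy
      where
      neg*neg : ∀ {a b c} → a * b ≈ c → - a * - b ≈ c
      neg*neg {a} {b} {c} eq = begin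
        - a * - b      ≈⟨ -‿distribˡ-* a (- b) ⟨
        - (a * - b)    ≈⟨ -‿cong (sym (-‿distribʳ-* a b)) ⟩
        - (- (a * b))  ≈⟨ -‿involutive (a * b) ⟩
        a * b          ≈⟨ eq ⟩
        c              ∎

    sym′ : ∀ {x y} → (x - y) #0 → (y - x) #0
    sym′ {x} {y} x#y = resp eq (inv⁻¹ (neg-invertible (inv x#y)))
      where
      eq : - (x - y) ≈ y - x
      eq = begin
        - (x - y)        ≈⟨ -‿+-comm x (- y) ⟨
        - x + - (- y)    ≈⟨ +-congˡ (-‿involutive y) ⟩
        - x + y          ≈⟨ +-comm (- x) y ⟩
        y - x            ∎

    cotrans′ : ∀ {x y} → (x - y) #0 → ∀ z → (x - z) #0 ⊎ (z - y) #0
    cotrans′ {x} {y} x#y z = split (resp eq x#y)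
      where
      eq : x - y ≈ (x - z) + (z - y)
      eq = begin
        x - y               ≈⟨ +-congʳ (x-y+y≈x x z) ⟨
        ((x - z) + z) - y   ≈⟨ +-assoc (x - z) z (- y) ⟩
        (x - z) + (z - y)   ∎

open import Relation.Binary.PropositionalEquality using (_≡_; _≢_; refl; sym; trans; cong; cong₂; subst; module ≡-Reasoning)

private
  module ℚ-lemmas where
    open import Data.Rational.Base using (_+_; _*_; _-_; -_; _<_; _≤_)
    open +-*-Solver

    halves : ∀ ε → ½ * ε + ½ * ε ≡ ε
    halves = solve 1 (λ ε → con ½ :* ε :+ con ½ :* ε := ε) refl

    *-pos : ∀ {p q} → 0ℚ < p → 0ℚ < q → 0ℚ < p * q
    *-pos {p} {q} 0<p 0<q =
      ℚ.positive⁻¹ (p * q) {{ℚ.pos*pos⇒pos p {{ℚ.positive 0<p}} q {{ℚ.positive 0<q}}}}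

    ½-pos : 0ℚ < ½
    ½-pos = ℚ.positive⁻¹ ½

    half-pos : ∀ {ε} → 0ℚ < ε → 0ℚ < ½ * ε
    half-pos = *-pos ½-pos

    pos-recip : ∀ {b} → 0ℚ < b → ∃[ c ] 0ℚ < c × b * c ≡ 1ℚ
    pos-recip {b} 0<b =
      (1/ b) , ℚ.positive⁻¹ (1/ b) {{ℚ.1/pos⇒pos b}} , ℚ.*-inverseʳ b
      where
      instance
        b-pos : ℚ.Positive b
        b-pos = ℚ.positive 0<b
        b-nz : ℚ.NonZero b
        b-nz = ℚ.pos⇒nonZero b

    *-mono-≤ : ∀ {p q r s} → 0ℚ ≤ p → 0ℚ ≤ s → p ≤ q → r ≤ s → p * r ≤ q * s
    *-mono-≤ {p} {q} {r} {s} 0≤p 0≤s p≤q r≤s =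
      ℚ.≤-trans (ℚ.*-monoˡ-≤-nonNeg p {{ℚ.nonNegative 0≤p}} r≤s)
                (ℚ.*-monoʳ-≤-nonNeg s {{ℚ.nonNegative 0≤s}} p≤q)

    ∣-∣-swap : ∀ p q → ∣ p - q ∣ ≡ ∣ q - p ∣
    ∣-∣-swap p q = trans (sym (ℚ.∣-p∣≡∣p∣ (p - q)))
      (cong ∣_∣ (solve 2 (λ p q → :- (p :- q) := q :- p) refl p q))

    ∣p∣≤∣q∣+∣q-p∣ : ∀ p q → ∣ p ∣ ≤ ∣ q ∣ + ∣ q - p ∣
    ∣p∣≤∣q∣+∣q-p∣ p q = subst (λ r → ∣ r ∣ ≤ ∣ q ∣ + ∣ q - p ∣)
      (solve 2 (λ p q → q :- (q :- p) := p) refl p q)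
      (ℚ.∣p-q∣≤∣p∣+∣q∣ q (q - p))

    +-split : ∀ {p q ε} → p < ½ * ε → q < ½ * ε → p + q < ε
    +-split {ε = ε} p< q< = subst (_ <_) (halves ε) (ℚ.+-mono-< p< q<)

    close-+ : ∀ {ε} p q r s → ∣ p - r ∣ < ½ * ε → ∣ q - s ∣ < ½ * ε →
              ∣ (p + q) - (r + s) ∣ < ε
    close-+ {ε} p q r s pr qs = ℚ.≤-<-trans
      (subst (λ t → ∣ t ∣ ≤ ∣ p - r ∣ + ∣ q - s ∣)
        (solve 4 (λ p q r s → (p :- r) :+ (q :- s) := (p :+ q) :- (r :+ s)) refl p q r s)
        (ℚ.∣p+q∣≤∣p∣+∣q∣ (p - r) (q - s)))
      (+-split pr qs)

    close-trans : ∀ {ε} p q r → ∣ p - q ∣ < ½ * ε → ∣ q - r ∣ < ½ * ε → ∣ p - r ∣ < ε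
    close-trans {ε} p q r pq qr = subst (λ t → ∣ t ∣ < ε)
      (solve 3 (λ p q r → (p :+ q) :- (q :+ r) := p :- r) refl p q r)
      (close-+ p q q r pq qr)

    close-neg : ∀ {ε} p q → ∣ p - q ∣ < ε → ∣ (- p) - (- q) ∣ < ε
    close-neg {ε} p q pq = subst (_< ε)
      (trans (∣-∣-swap p q) (cong ∣_∣ (solve 2 (λ p q → q :- p := (:- p) :- (:- q)) refl p q))) pq

    -- Below, b * c ≡ 1ℚ expresses that c is the reciprocal of b.
    scale-< : ∀ {b c ε} p q → 0ℚ < b → b * c ≡ 1ℚ → ∣ p ∣ ≤ b → ∣ q ∣ < ε * c → ∣ p * q ∣ < ε
    scale-< {b} {c} {ε} p q 0<b bc p≤b q< = begin-strict
      ∣ p * q ∣      ≡⟨ ℚ.∣p*q∣≡∣p∣*∣q∣ p q ⟩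
      ∣ p ∣ * ∣ q ∣  ≤⟨ ℚ.*-monoʳ-≤-nonNeg ∣ q ∣ {{ℚ.∣-∣-nonNeg q}} p≤b ⟩
      b * ∣ q ∣      <⟨ ℚ.*-monoʳ-<-pos b {{ℚ.positive 0<b}} q< ⟩
      b * (ε * c)    ≡⟨ solve 3 (λ b c ε → b :* (ε :* c) := ε :* (b :* c)) refl b c ε ⟩
      ε * (b * c)    ≡⟨ cong (ε *_) bc ⟩
      ε * 1ℚ         ≡⟨ ℚ.*-identityʳ ε ⟩
      ε              ∎
      where open ℚ.≤-Reasoning

    close-* : ∀ {b c d e ε} p q r s →
              0ℚ < b → b * c ≡ 1ℚ → 0ℚ < d → d * e ≡ 1ℚ → ∣ p ∣ ≤ b → ∣ s ∣ ≤ d →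
              ∣ p - r ∣ < (½ * ε) * e → ∣ q - s ∣ < (½ * ε) * c →
              ∣ p * q - r * s ∣ < ε
    close-* {ε = ε} p q r s 0<b bc 0<d de p≤ s≤ pr qs = ℚ.≤-<-trans
      (subst (λ t → ∣ t ∣ ≤ ∣ p * (q - s) ∣ + ∣ s * (p - r) ∣)
        (solve 4 (λ p q r s → p :* (q :- s) :+ s :* (p :- r) := p :* q :- r :* s) refl p q r s)
        (ℚ.∣p+q∣≤∣p∣+∣q∣ (p * (q - s)) (s * (p - r))))
      (+-split (scale-< p (q - s) 0<b bc p≤ qs) (scale-< s (p - r) 0<d de s≤ pr))

    recipℚ : ℚ → ℚ
    recipℚ p with p ℚ.≟ 0ℚ
    ... | yes _   = 0ℚ
    ... | no  p≢0 = 1/_ p {{ℚ.≢-nonZero p≢0}}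

    away⇒≢0 : ∀ {ε p} → 0ℚ < ε → ε ≤ ∣ p ∣ → p ≢ 0ℚ
    away⇒≢0 0<ε ε≤ refl = ℚ.<-irrefl refl (ℚ.<-≤-trans 0<ε ε≤)

    *-recip : ∀ p → p ≢ 0ℚ → p * recipℚ p ≡ 1ℚ
    *-recip p p≢0 with p ℚ.≟ 0ℚ
    ... | yes p≡0 = ⊥-elim (p≢0 p≡0)
    ... | no  p≢0 = ℚ.*-inverseʳ p {{ℚ.≢-nonZero p≢0}}

    ∣recipℚ∣≤ : ∀ {ε δ} p → 0ℚ < ε → ε * δ ≡ 1ℚ → ε ≤ ∣ p ∣ → ∣ recipℚ p ∣ ≤ δ
    ∣recipℚ∣≤ {ε} {δ} p 0<ε εδ ε≤ = ℚ.*-cancelˡ-≤-pos ε {{ℚ.positive 0<ε}} (begin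
      ε * ∣ recipℚ p ∣      ≤⟨ ℚ.*-monoʳ-≤-nonNeg ∣ recipℚ p ∣ {{ℚ.∣-∣-nonNeg (recipℚ p)}} ε≤ ⟩
      ∣ p ∣ * ∣ recipℚ p ∣  ≡⟨ sym (ℚ.∣p*q∣≡∣p∣*∣q∣ p (recipℚ p)) ⟩
      ∣ p * recipℚ p ∣      ≡⟨ cong ∣_∣ (*-recip p (away⇒≢0 0<ε ε≤)) ⟩
      1ℚ                   ≡⟨ sym εδ ⟩
      ε * δ                ∎)
      where open ℚ.≤-Reasoning

    close-recip : ∀ {ε δ η} p q → 0ℚ < ε → 0ℚ < δ → ε * δ ≡ 1ℚ → ε ≤ ∣ p ∣ → ε ≤ ∣ q ∣ →
                  ∣ p - q ∣ < η * (ε * ε) → ∣ recipℚ p - recipℚ q ∣ < η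
    close-recip {ε} {δ} {η} p q 0<ε 0<δ εδ ε≤p ε≤q pq = subst (λ t → ∣ t ∣ < η) eq
      (scale-< (recipℚ p * recipℚ q) (q - p) (*-pos 0<δ 0<δ) δδεε
        (subst (_≤ δ * δ) (sym (ℚ.∣p*q∣≡∣p∣*∣q∣ (recipℚ p) (recipℚ q)))
          (*-mono-≤ (ℚ.0≤∣p∣ (recipℚ p)) (ℚ.<⇒≤ 0<δ) (∣recipℚ∣≤ p 0<ε εδ ε≤p) (∣recipℚ∣≤ q 0<ε εδ ε≤q)))
        (subst (_< _) (∣-∣-swap p q) pq))
      where
      δδεε : (δ * δ) * (ε * ε) ≡ 1ℚ
      δδεε = trans (solve 2 (λ ε δ → (δ :* δ) :* (ε :* ε) := (ε :* δ) :* (ε :* δ)) refl ε δ)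
                   (cong₂ _*_ εδ εδ)
      eq : recipℚ p * recipℚ q * (q - p) ≡ recipℚ p - recipℚ q
      eq = begin
        recipℚ p * recipℚ q * (q - p)
          ≡⟨ solve 4 (λ p q r s → r :* s :* (q :- p) := r :* (q :* s) :- (p :* r) :* s)
               refl p q (recipℚ p) (recipℚ q) ⟩
        recipℚ p * (q * recipℚ q) - (p * recipℚ p) * recipℚ q
          ≡⟨ cong₂ (λ a b → recipℚ p * a - b * recipℚ q)
               (*-recip q (away⇒≢0 0<ε ε≤q)) (*-recip p (away⇒≢0 0<ε ε≤p)) ⟩
        recipℚ p * 1ℚ - 1ℚ * recipℚ q
          ≡⟨ cong₂ _-_ (ℚ.*-identityʳ (recipℚ p)) (ℚ.*-identityˡ (recipℚ q)) ⟩
        recipℚ p - recipℚ q ∎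
        where open ≡-Reasoning

    stay-away : ∀ {ε} p q → ε ≤ ∣ p ∣ → ∣ p - q ∣ < ½ * ε → ½ * ε ≤ ∣ q ∣
    stay-away {ε} p q ε≤ pq with ½ * ε ℚ.≤? ∣ q ∣
    ... | yes le = le
    ... | no ¬le = ⊥-elim (ℚ.<-irrefl refl (ℚ.≤-<-trans
            (ℚ.≤-trans ε≤ (ℚ.≤-trans (∣p∣≤∣q∣+∣q-p∣ p q)
               (ℚ.≤-reflexive (cong (∣ q ∣ +_) (∣-∣-swap q p)))))
            (+-split (ℚ.≰⇒> ¬le) pq)))

    sum-away : ∀ {ε} p q → ε ≤ ∣ p + q ∣ → (½ * ε ≤ ∣ p ∣) ⊎ (½ * ε ≤ ∣ q ∣)
    sum-away {ε} p q ε≤ with ½ * ε ℚ.≤? ∣ p ∣ | ½ * ε ℚ.≤? ∣ q ∣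
    ... | yes le | _      = inj₁ le
    ... | no _   | yes le = inj₂ le
    ... | no ¬p  | no ¬q  = ⊥-elim (ℚ.<-irrefl refl (ℚ.≤-<-trans
            (ℚ.≤-trans ε≤ (ℚ.∣p+q∣≤∣p∣+∣q∣ p q)) (+-split (ℚ.≰⇒> ¬p) (ℚ.≰⇒> ¬q))))

    factor-away : ∀ {b c ε} p q → 0ℚ < b → b * c ≡ 1ℚ → ε ≤ ∣ p * q ∣ → ∣ q ∣ ≤ b → ε * c ≤ ∣ p ∣
    factor-away {b} {c} {ε} p q 0<b bc ε≤ q≤ = ℚ.*-cancelʳ-≤-pos b {{ℚ.positive 0<b}} (begin
      ε * c * b      ≡⟨ solve 3 (λ b c ε → ε :* c :* b := ε :* (b :* c)) refl b c ε ⟩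
      ε * (b * c)    ≡⟨ trans (cong (ε *_) bc) (ℚ.*-identityʳ ε) ⟩
      ε              ≤⟨ ε≤ ⟩
      ∣ p * q ∣      ≡⟨ ℚ.∣p*q∣≡∣p∣*∣q∣ p q ⟩
      ∣ p ∣ * ∣ q ∣  ≤⟨ ℚ.*-monoˡ-≤-nonNeg ∣ p ∣ {{ℚ.∣-∣-nonNeg p}} q≤ ⟩
      ∣ p ∣ * b      ∎)
      where open ℚ.≤-Reasoning

    0≤p*p : ∀ p → 0ℚ ≤ p * p
    0≤p*p p = subst (0ℚ ≤_) ∣p∣²≡p²
      (ℚ.nonNegative⁻¹ _ {{ℚ.nonNeg*nonNeg⇒nonNeg (∣ p ∣) {{ℚ.∣-∣-nonNeg p}} (∣ p ∣) {{ℚ.∣-∣-nonNeg p}}}})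
      where
      ∣p∣²≡p² : ∣ p ∣ * ∣ p ∣ ≡ p * p
      ∣p∣²≡p² with ℚ.∣p∣≡p∨∣p∣≡-p p
      ... | inj₁ eq = cong₂ _*_ eq eq
      ... | inj₂ eq = trans (cong₂ _*_ eq eq) (solve 1 (λ p → (:- p) :* (:- p) := p :* p) refl p)

    squares-away : ∀ {ε} p q → 0ℚ < ε → ε ≤ ∣ p ∣ → ε * ε ≤ ∣ p * p + q * q ∣
    squares-away {ε} p q 0<ε ε≤ = begin
      ε * ε              ≤⟨ *-mono-≤ (ℚ.<⇒≤ 0<ε) (ℚ.0≤∣p∣ p) ε≤ ε≤ ⟩
      ∣ p ∣ * ∣ p ∣      ≡⟨ sym (ℚ.∣p*q∣≡∣p∣*∣q∣ p p) ⟩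
      ∣ p * p ∣          ≡⟨ ℚ.0≤p⇒∣p∣≡p (0≤p*p p) ⟩
      p * p              ≡⟨ sym (ℚ.+-identityʳ (p * p)) ⟩
      p * p + 0ℚ         ≤⟨ ℚ.+-monoʳ-≤ (p * p) (0≤p*p q) ⟩
      p * p + q * q      ≡⟨ sym (ℚ.0≤p⇒∣p∣≡p (ℚ.+-mono-≤ (0≤p*p p) (0≤p*p q))) ⟩
      ∣ p * p + q * q ∣  ∎
      where open ℚ.≤-Reasoning

Cauchy : (ℕ → ℚ) → Set
Cauchy a = ∀ ε → 0ℚ ℚ.< ε → ∃[ N ] ∀ m n → N ℕ.≤ m → N ℕ.≤ n → ∣ a m ℚ.- a n ∣ ℚ.< ε

-- Real numbers are Cauchy sequences of rationals, considered up to _≈ᴿ_.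
record ℝ : Set where
  no-eta-equality
  constructor mkℝ
  field
    seq    : ℕ → ℚ
    cauchy : Cauchy seq

open ℝ public

infix 4 _≈ᴿ_

record _≈ᴿ_ (x y : ℝ) : Set where
  constructor mk≈
  field
    close : ∀ ε → 0ℚ ℚ.< ε → ∃[ N ] ∀ n → N ℕ.≤ n → ∣ seq x n ℚ.- seq y n ∣ ℚ.< ε

open _≈ᴿ_ public

open ℚ-lemmas
private
  module ⊔ where
    m≤ : ∀ {m n o} → m ℕ.⊔ n ℕ.≤ o → m ℕ.≤ o
    m≤ {m} {n} = ℕ.m⊔n≤o⇒m≤o m n
    n≤ : ∀ {m n o} → m ℕ.⊔ n ℕ.≤ o → n ℕ.≤ o
    n≤ {m} {n} = ℕ.m⊔n≤o⇒n≤o m n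

  bounded : ∀ x → ∃[ b ] ∃[ c ] ∃[ N ] 0ℚ ℚ.< b × 0ℚ ℚ.< c × b ℚ.* c ≡ 1ℚ ×
            (∀ n → N ℕ.≤ n → ∣ seq x n ∣ ℚ.≤ b)
  bounded x with cauchy x 1ℚ (ℚ.positive⁻¹ 1ℚ)
  ... | N , close-x = b , c , N , 0<b , 0<c , bc , λ n N≤n →
          ℚ.≤-trans (∣p∣≤∣q∣+∣q-p∣ (seq x n) (seq x N))
                    (ℚ.+-monoʳ-≤ ∣ seq x N ∣ (ℚ.<⇒≤ (close-x N n ℕ.≤-refl N≤n)))
    where
    b = ∣ seq x N ∣ ℚ.+ 1ℚ
    0<b : 0ℚ ℚ.< b
    0<b = ℚ.+-mono-≤-< (ℚ.0≤∣p∣ (seq x N)) (ℚ.positive⁻¹ 1ℚ)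
    c   = proj₁ (pos-recip 0<b)
    0<c = proj₁ (proj₂ (pos-recip 0<b))
    bc  = proj₂ (proj₂ (pos-recip 0<b))

fromℚ : ℚ → ℝ
fromℚ q = mkℝ (λ _ → q) λ ε 0<ε → 0 , λ _ _ _ _ →
  subst (λ p → ∣ p ∣ ℚ.< ε) (sym (ℚ.+-inverseʳ q)) 0<ε

infixl 6 _+ᴿ_
infixl 7 _*ᴿ_
infix  8 -ᴿ_

_+ᴿ_ _*ᴿ_ : ℝ → ℝ → ℝ
-ᴿ_ : ℝ → ℝ

seq    (x +ᴿ y) n = seq x n ℚ.+ seq y n
cauchy (x +ᴿ y) ε 0<ε =
  let M , cx = cauchy x _ (half-pos 0<ε)
      N , cy = cauchy y _ (half-pos 0<ε)
  in M ℕ.⊔ N , λ m n m≥ n≥ → close-+ (seq x m) (seq y m) (seq x n) (seq y n)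
       (cx m n (⊔.m≤ m≥) (⊔.m≤ n≥)) (cy m n (⊔.n≤ {M} m≥) (⊔.n≤ {M} n≥))

seq    (x *ᴿ y) n = seq x n ℚ.* seq y n
cauchy (x *ᴿ y) ε 0<ε =
  let b , c , J , 0<b , 0<c , bc , x≤b = bounded x
      d , e , K , 0<d , 0<e , de , y≤d = bounded y
      M , cx = cauchy x _ (*-pos (half-pos 0<ε) 0<e)
      N , cy = cauchy y _ (*-pos (half-pos 0<ε) 0<c)
  in (J ℕ.⊔ K) ℕ.⊔ (M ℕ.⊔ N) , λ m n m≥ n≥ →
       close-* (seq x m) (seq y m) (seq x n) (seq y n) 0<b bc 0<d de
         (x≤b m (⊔.m≤ (⊔.m≤ m≥))) (y≤d n (⊔.n≤ {J} (⊔.m≤ n≥)))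
         (cx m n (⊔.m≤ (⊔.n≤ {J ℕ.⊔ K} m≥)) (⊔.m≤ (⊔.n≤ {J ℕ.⊔ K} n≥)))
         (cy m n (⊔.n≤ {M} (⊔.n≤ {J ℕ.⊔ K} m≥)) (⊔.n≤ {M} (⊔.n≤ {J ℕ.⊔ K} n≥)))

seq    (-ᴿ x) n = ℚ.- seq x n
cauchy (-ᴿ x) ε 0<ε with N , close-x ← cauchy x ε 0<ε =
  N , λ m n m≥ n≥ → close-neg (seq x m) (seq x n) (close-x m n m≥ n≥)

0ᴿ 1ᴿ : ℝ
0ᴿ = fromℚ 0ℚ
1ᴿ = fromℚ 1ℚ

private
  pointwise : ∀ {x y} → (∀ n → seq x n ≡ seq y n) → x ≈ᴿ y
  pointwise {x} {y} eq = mk≈ λ ε 0<ε → 0 , λ n _ →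
    subst (λ p → ∣ p ∣ ℚ.< ε)
      (sym (trans (cong (ℚ._- seq y n) (eq n)) (ℚ.+-inverseʳ (seq y n)))) 0<ε

  ≈ᴿ-refl : ∀ {x} → x ≈ᴿ x
  ≈ᴿ-refl = pointwise λ _ → refl

  ≈ᴿ-sym : ∀ {x y} → x ≈ᴿ y → y ≈ᴿ x
  ≈ᴿ-sym {x} {y} x≈y = mk≈ λ ε 0<ε → let N , c = close x≈y ε 0<ε in
    N , λ n n≥ → subst (ℚ._< ε) (∣-∣-swap (seq x n) (seq y n)) (c n n≥)

  ≈ᴿ-trans : ∀ {x y z} → x ≈ᴿ y → y ≈ᴿ z → x ≈ᴿ z
  ≈ᴿ-trans {x} {y} {z} x≈y y≈z = mk≈ λ ε 0<ε →
    let M , c = close x≈y _ (half-pos 0<ε)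
        N , d = close y≈z _ (half-pos 0<ε)
    in M ℕ.⊔ N , λ n n≥ →
         close-trans (seq x n) (seq y n) (seq z n) (c n (⊔.m≤ n≥)) (d n (⊔.n≤ {M} n≥))

  +ᴿ-cong : ∀ {x x′ y y′} → x ≈ᴿ x′ → y ≈ᴿ y′ → x +ᴿ y ≈ᴿ x′ +ᴿ y′
  +ᴿ-cong {x} {x′} {y} {y′} x≈ y≈ = mk≈ λ ε 0<ε →
    let M , c = close x≈ _ (half-pos 0<ε)
        N , d = close y≈ _ (half-pos 0<ε)
    in M ℕ.⊔ N , λ n n≥ →
         close-+ (seq x n) (seq y n) (seq x′ n) (seq y′ n) (c n (⊔.m≤ n≥)) (d n (⊔.n≤ {M} n≥))

  *ᴿ-cong : ∀ {x x′ y y′} → x ≈ᴿ x′ → y ≈ᴿ y′ → x *ᴿ y ≈ᴿ x′ *ᴿ y′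
  *ᴿ-cong {x} {x′} {y} {y′} x≈ y≈ = mk≈ λ ε 0<ε →
    let b , c , J , 0<b , 0<c , bc , x≤b = bounded x
        d , e , K , 0<d , 0<e , de , y≤d = bounded y′
        M , cx = close x≈ _ (*-pos (half-pos 0<ε) 0<e)
        N , cy = close y≈ _ (*-pos (half-pos 0<ε) 0<c)
    in (J ℕ.⊔ K) ℕ.⊔ (M ℕ.⊔ N) , λ n n≥ →
         close-* (seq x n) (seq y n) (seq x′ n) (seq y′ n) 0<b bc 0<d de
           (x≤b n (⊔.m≤ (⊔.m≤ n≥))) (y≤d n (⊔.n≤ {J} (⊔.m≤ n≥)))
           (cx n (⊔.m≤ (⊔.n≤ {J ℕ.⊔ K} n≥))) (cy n (⊔.n≤ {M} (⊔.n≤ {J ℕ.⊔ K} n≥)))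

  -ᴿ-cong : ∀ {x y} → x ≈ᴿ y → -ᴿ x ≈ᴿ -ᴿ y
  -ᴿ-cong {x} {y} x≈y = mk≈ λ ε 0<ε → let N , c = close x≈y ε 0<ε in
    N , λ n n≥ → close-neg (seq x n) (seq y n) (c n n≥)

  +ᴿ-assoc : ∀ x y z → (x +ᴿ y) +ᴿ z ≈ᴿ x +ᴿ (y +ᴿ z)
  +ᴿ-assoc x y z = pointwise λ n → ℚ.+-assoc (seq x n) (seq y n) (seq z n)

  +ᴿ-comm : ∀ x y → x +ᴿ y ≈ᴿ y +ᴿ x
  +ᴿ-comm x y = pointwise λ n → ℚ.+-comm (seq x n) (seq y n)

  +ᴿ-identityˡ : ∀ x → 0ᴿ +ᴿ x ≈ᴿ x
  +ᴿ-identityˡ x = pointwise λ n → ℚ.+-identityˡ (seq x n)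

  -ᴿ-inverseˡ : ∀ x → (-ᴿ x) +ᴿ x ≈ᴿ 0ᴿ
  -ᴿ-inverseˡ x = pointwise λ n → ℚ.+-inverseˡ (seq x n)

  *ᴿ-assoc : ∀ x y z → (x *ᴿ y) *ᴿ z ≈ᴿ x *ᴿ (y *ᴿ z)
  *ᴿ-assoc x y z = pointwise λ n → ℚ.*-assoc (seq x n) (seq y n) (seq z n)

  *ᴿ-comm : ∀ x y → x *ᴿ y ≈ᴿ y *ᴿ x
  *ᴿ-comm x y = pointwise λ n → ℚ.*-comm (seq x n) (seq y n)

  *ᴿ-identityˡ : ∀ x → 1ᴿ *ᴿ x ≈ᴿ x
  *ᴿ-identityˡ x = pointwise λ n → ℚ.*-identityˡ (seq x n)

  *ᴿ-distribˡ : ∀ x y z → x *ᴿ (y +ᴿ z) ≈ᴿ x *ᴿ y +ᴿ x *ᴿ z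
  *ᴿ-distribˡ x y z = pointwise λ n → ℚ.*-distribˡ-+ (seq x n) (seq y n) (seq z n)

ℝ-commutativeRing : CommutativeRing 0ℓ 0ℓ
ℝ-commutativeRing = record
  { isCommutativeRing = mkCommutativeRing
      (record { refl = ≈ᴿ-refl ; sym = ≈ᴿ-sym ; trans = ≈ᴿ-trans })
      {_+_ = _+ᴿ_} {_*_ = _*ᴿ_} { -_ = -ᴿ_} {0# = 0ᴿ} {1# = 1ᴿ}
      +ᴿ-cong *ᴿ-cong -ᴿ-cong +ᴿ-assoc +ᴿ-comm +ᴿ-identityˡ -ᴿ-inverseˡ
      *ᴿ-assoc *ᴿ-comm *ᴿ-identityˡ *ᴿ-distribˡ }

infix 4 _#0ᴿ

-- The positive form of x ≠ 0: eventually ∣ x ∣ is bounded below by a positive rational.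
-- Its negation is equivalent to x ≈ᴿ 0ᴿ.
record _#0ᴿ (x : ℝ) : Set where
  constructor mk#0
  field
    gap     : ℚ
    gap-pos : 0ℚ ℚ.< gap
    from    : ℕ
    away    : ∀ n → from ℕ.≤ n → gap ℚ.≤ ∣ seq x n ∣

private
  #0ᴿ-resp : ∀ {x y} → x ≈ᴿ y → x #0ᴿ → y #0ᴿ
  #0ᴿ-resp {x} {y} x≈y (mk#0 ε 0<ε M ε≤) =
    let N , c = close x≈y _ (half-pos 0<ε) in
    mk#0 (½ ℚ.* ε) (half-pos 0<ε) (M ℕ.⊔ N) λ n n≥ →
      stay-away (seq x n) (seq y n) (ε≤ n (⊔.m≤ n≥)) (c n (⊔.n≤ {M} n≥))

  one-term-away : ∀ x {ε} (0<ε : 0ℚ ℚ.< ε) n →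
                  proj₁ (cauchy x _ (half-pos 0<ε)) ℕ.≤ n → ε ℚ.≤ ∣ seq x n ∣ → x #0ᴿ
  one-term-away x {ε} 0<ε n n≥ ε≤ =
    let N , c = cauchy x _ (half-pos 0<ε) in
    mk#0 (½ ℚ.* ε) (half-pos 0<ε) N λ m m≥ →
      stay-away (seq x n) (seq x m) ε≤ (c n m n≥ m≥)

  #0ᴿ-split : ∀ {x y} → (x +ᴿ y) #0ᴿ → x #0ᴿ ⊎ y #0ᴿ
  #0ᴿ-split {x} {y} (mk#0 ε 0<ε K ε≤) =
    [ (λ le → inj₁ (one-term-away x (half-pos 0<ε) n (⊔.m≤ (⊔.n≤ {K} ℕ.≤-refl)) le))
    , (λ le → inj₂ (one-term-away y (half-pos 0<ε) n (⊔.n≤ {M} (⊔.n≤ {K} ℕ.≤-refl)) le))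
    ]′ (sum-away (seq x n) (seq y n) (ε≤ n (⊔.m≤ {K} ℕ.≤-refl)))
    where
    M = proj₁ (cauchy x _ (half-pos (half-pos 0<ε)))
    N = proj₁ (cauchy y _ (half-pos (half-pos 0<ε)))
    n = K ℕ.⊔ (M ℕ.⊔ N)

  #0ᴿ-tight : ∀ {x} → ¬ (x #0ᴿ) → x ≈ᴿ 0ᴿ
  #0ᴿ-tight {x} ¬x#0 = mk≈ λ ε 0<ε → proj₁ (cauchy x _ (half-pos 0<ε)) , λ n n≥ →
    subst (λ p → ∣ p ∣ ℚ.< ε) (sym (ℚ.+-identityʳ (seq x n)))
      (ℚ.≰⇒> λ ε≤ → ¬x#0 (one-term-away x 0<ε n n≥ ε≤))

  ¬0#0ᴿ : ¬ (0ᴿ #0ᴿ)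
  ¬0#0ᴿ (mk#0 ε 0<ε N ε≤) = ℚ.<-irrefl refl (ℚ.<-≤-trans 0<ε (ε≤ N ℕ.≤-refl))

  1#0ᴿ : 1ᴿ #0ᴿ
  1#0ᴿ = mk#0 1ℚ (ℚ.positive⁻¹ 1ℚ) 0 λ _ _ → ℚ.≤-refl

  #0ᴿ-neg : ∀ {x} → (-ᴿ x) #0ᴿ → x #0ᴿ
  #0ᴿ-neg {x} (mk#0 ε 0<ε N ε≤) =
    mk#0 ε 0<ε N λ n n≥ → subst (ε ℚ.≤_) (ℚ.∣-p∣≡∣p∣ (seq x n)) (ε≤ n n≥)

  #0ᴿ-factorˡ : ∀ {x y} → (x *ᴿ y) #0ᴿ → x #0ᴿ
  #0ᴿ-factorˡ {x} {y} (mk#0 ε 0<ε M ε≤) =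
    let b , c , N , 0<b , 0<c , bc , y≤b = bounded y in
    mk#0 (ε ℚ.* c) (*-pos 0<ε 0<c) (M ℕ.⊔ N) λ n n≥ →
      factor-away (seq x n) (seq y n) 0<b bc (ε≤ n (⊔.m≤ n≥)) (y≤b n (⊔.n≤ {M} n≥))

  #0ᴿ-squares : ∀ x y → x #0ᴿ → (x *ᴿ x +ᴿ y *ᴿ y) #0ᴿ
  #0ᴿ-squares x y (mk#0 ε 0<ε N ε≤) =
    mk#0 (ε ℚ.* ε) (*-pos 0<ε 0<ε) N λ n n≥ → squares-away (seq x n) (seq y n) 0<ε (ε≤ n n≥)

  recipᴿ : ∀ x → x #0ᴿ → ℝ
  recipᴿ x (mk#0 ε 0<ε M ε≤) = mkℝ (λ n → recipℚ (seq x n)) λ η 0<η →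
    let δ , 0<δ , εδ = pos-recip 0<ε
        N , c = cauchy x _ (*-pos 0<η (*-pos 0<ε 0<ε))
    in M ℕ.⊔ N , λ m n m≥ n≥ →
         close-recip (seq x m) (seq x n) 0<ε 0<δ εδ (ε≤ m (⊔.m≤ m≥)) (ε≤ n (⊔.m≤ n≥))
           (c m n (⊔.n≤ {M} m≥) (⊔.n≤ {M} n≥))

  *-recipᴿ : ∀ x (x#0 : x #0ᴿ) → x *ᴿ recipᴿ x x#0 ≈ᴿ 1ᴿ
  *-recipᴿ x (mk#0 ε 0<ε M ε≤) = mk≈ λ η 0<η → M , λ n n≥ →
    subst (λ p → ∣ p ∣ ℚ.< η)
      (sym (trans (cong (ℚ._- 1ℚ) (*-recip (seq x n) (away⇒≢0 0<ε (ε≤ n n≥)))) (ℚ.+-inverseʳ 1ℚ)))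
      0<η

  #0ᴿ⇒invertible : ∀ {x} → x #0ᴿ → Invertible _≈ᴿ_ 1ᴿ _*ᴿ_ x
  #0ᴿ⇒invertible {x} x#0 =
    recipᴿ x x#0 , ≈ᴿ-trans (*ᴿ-comm _ x) (*-recipᴿ x x#0) , *-recipᴿ x x#0

  invertible⇒#0ᴿ : ∀ {x} → Invertible _≈ᴿ_ 1ᴿ _*ᴿ_ x → x #0ᴿ
  invertible⇒#0ᴿ (_ , _ , xy≈1) = #0ᴿ-factorˡ (#0ᴿ-resp (≈ᴿ-sym xy≈1) 1#0ᴿ)

ℝ-heytingField : HeytingField 0ℓ 0ℓ 0ℓ
ℝ-heytingField = mkHeytingField ℝ-commutativeRing _#0ᴿ
  #0ᴿ-resp #0ᴿ-split #0ᴿ-tight ¬0#0ᴿ #0ᴿ⇒invertible invertible⇒#0ᴿ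

infix 5 _+i_

record ℂ : Set where
  constructor _+i_
  field
    re im : ℝ

open ℂ public

infix 4 _≈ᶜ_ _#0ᶜ

record _≈ᶜ_ (z w : ℂ) : Set where
  constructor mk≈
  field
    re≈ : re z ≈ᴿ re w
    im≈ : im z ≈ᴿ im w

_#0ᶜ : ℂ → Set
z #0ᶜ = re z #0ᴿ ⊎ im z #0ᴿ

infixl 6 _+ᶜ_
infixl 7 _*ᶜ_
infix  8 -ᶜ_

_+ᶜ_ _*ᶜ_ : ℂ → ℂ → ℂ
z +ᶜ w = (re z +ᴿ re w) +i (im z +ᴿ im w)
z *ᶜ w = (re z *ᴿ re w +ᴿ -ᴿ (im z *ᴿ im w)) +i (re z *ᴿ im w +ᴿ im z *ᴿ re w)

-ᶜ_ : ℂ → ℂ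
-ᶜ z = (-ᴿ re z) +i (-ᴿ im z)

fromℝ : ℝ → ℂ
fromℝ x = x +i 0ᴿ

0ᶜ 1ᶜ : ℂ
0ᶜ = fromℝ 0ᴿ
1ᶜ = fromℝ 1ᴿ

private
  open +-*-Solver

  *ᶜ-cong : ∀ {z z′ w w′} → z ≈ᶜ z′ → w ≈ᶜ w′ → z *ᶜ w ≈ᶜ z′ *ᶜ w′
  *ᶜ-cong (mk≈ a b) (mk≈ c d) = mk≈
    (+ᴿ-cong (*ᴿ-cong a c) (-ᴿ-cong (*ᴿ-cong b d)))
    (+ᴿ-cong (*ᴿ-cong a d) (*ᴿ-cong b c))

  *ᶜ-assoc : ∀ z w v → (z *ᶜ w) *ᶜ v ≈ᶜ z *ᶜ (w *ᶜ v)
  *ᶜ-assoc (a +i b) (c +i d) (e +i f) = mk≈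
    (pointwise λ n → solve 6 (λ a b c d e f →
        (a :* c :+ :- (b :* d)) :* e :+ :- ((a :* d :+ b :* c) :* f)
          := a :* (c :* e :+ :- (d :* f)) :+ :- (b :* (c :* f :+ d :* e)))
      refl (seq a n) (seq b n) (seq c n) (seq d n) (seq e n) (seq f n))
    (pointwise λ n → solve 6 (λ a b c d e f →
        (a :* c :+ :- (b :* d)) :* f :+ (a :* d :+ b :* c) :* e
          := a :* (c :* f :+ d :* e) :+ b :* (c :* e :+ :- (d :* f)))
      refl (seq a n) (seq b n) (seq c n) (seq d n) (seq e n) (seq f n))

  *ᶜ-comm : ∀ z w → z *ᶜ w ≈ᶜ w *ᶜ z
  *ᶜ-comm (a +i b) (c +i d) = mk≈
    (pointwise λ n → solve 4 (λ a b c d →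
        a :* c :+ :- (b :* d) := c :* a :+ :- (d :* b))
      refl (seq a n) (seq b n) (seq c n) (seq d n))
    (pointwise λ n → solve 4 (λ a b c d →
        a :* d :+ b :* c := c :* b :+ d :* a)
      refl (seq a n) (seq b n) (seq c n) (seq d n))

  *ᶜ-identityˡ : ∀ z → 1ᶜ *ᶜ z ≈ᶜ z
  *ᶜ-identityˡ (a +i b) = mk≈
    (pointwise λ n → solve 2 (λ a b → con 1ℚ :* a :+ :- (con 0ℚ :* b) := a)
      refl (seq a n) (seq b n))
    (pointwise λ n → solve 2 (λ a b → con 1ℚ :* b :+ con 0ℚ :* a := b)
      refl (seq a n) (seq b n))

  *ᶜ-distribˡ : ∀ z w v → z *ᶜ (w +ᶜ v) ≈ᶜ z *ᶜ w +ᶜ z *ᶜ v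
  *ᶜ-distribˡ (a +i b) (c +i d) (e +i f) = mk≈
    (pointwise λ n → solve 6 (λ a b c d e f →
        a :* (c :+ e) :+ :- (b :* (d :+ f))
          := (a :* c :+ :- (b :* d)) :+ (a :* e :+ :- (b :* f)))
      refl (seq a n) (seq b n) (seq c n) (seq d n) (seq e n) (seq f n))
    (pointwise λ n → solve 6 (λ a b c d e f →
        a :* (d :+ f) :+ b :* (c :+ e)
          := (a :* d :+ b :* c) :+ (a :* f :+ b :* e))
      refl (seq a n) (seq b n) (seq c n) (seq d n) (seq e n) (seq f n))

ℂ-commutativeRing : CommutativeRing 0ℓ 0ℓ
ℂ-commutativeRing = record
  { isCommutativeRing = mkCommutativeRing
      (record
        { refl  = mk≈ ≈ᴿ-refl ≈ᴿ-refl
        ; sym   = λ { (mk≈ p q) → mk≈ (≈ᴿ-sym p) (≈ᴿ-sym q) }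
        ; trans = λ { (mk≈ p q) (mk≈ r s) → mk≈ (≈ᴿ-trans p r) (≈ᴿ-trans q s) } })
      {_+_ = _+ᶜ_} {_*_ = _*ᶜ_} { -_ = -ᶜ_} {0# = 0ᶜ} {1# = 1ᶜ}
      (λ { (mk≈ p q) (mk≈ r s) → mk≈ (+ᴿ-cong p r) (+ᴿ-cong q s) })
      *ᶜ-cong
      (λ { (mk≈ p q) → mk≈ (-ᴿ-cong p) (-ᴿ-cong q) })
      (λ z w v → mk≈ (+ᴿ-assoc (re z) (re w) (re v)) (+ᴿ-assoc (im z) (im w) (im v)))
      (λ z w → mk≈ (+ᴿ-comm (re z) (re w)) (+ᴿ-comm (im z) (im w)))
      (λ z → mk≈ (+ᴿ-identityˡ (re z)) (+ᴿ-identityˡ (im z)))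
      (λ z → mk≈ (-ᴿ-inverseˡ (re z)) (-ᴿ-inverseˡ (im z)))
      *ᶜ-assoc *ᶜ-comm *ᶜ-identityˡ *ᶜ-distribˡ }

private
  module ℂR = CommutativeRing ℂ-commutativeRing

  #0ᶜ-split : ∀ {z w} → (z +ᶜ w) #0ᶜ → z #0ᶜ ⊎ w #0ᶜ
  #0ᶜ-split (inj₁ p) = [ (λ q → inj₁ (inj₁ q)) , (λ q → inj₂ (inj₁ q)) ]′ (#0ᴿ-split p)
  #0ᶜ-split (inj₂ p) = [ (λ q → inj₁ (inj₂ q)) , (λ q → inj₂ (inj₂ q)) ]′ (#0ᴿ-split p)

  norm² : ℂ → ℝ
  norm² z = re z *ᴿ re z +ᴿ im z *ᴿ im z

  norm²#0 : ∀ z → z #0ᶜ → norm² z #0ᴿ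
  norm²#0 z (inj₁ p) = #0ᴿ-squares (re z) (im z) p
  norm²#0 z (inj₂ p) = #0ᴿ-resp (+ᴿ-comm (im z *ᴿ im z) (re z *ᴿ re z)) (#0ᴿ-squares (im z) (re z) p)

  recipᶜ : ∀ z → z #0ᶜ → ℂ
  recipᶜ z z#0 = let r = recipᴿ (norm² z) (norm²#0 z z#0) in (re z *ᴿ r) +i (-ᴿ im z *ᴿ r)

  *-recipᶜ : ∀ z z#0 → z *ᶜ recipᶜ z z#0 ≈ᶜ 1ᶜ
  *-recipᶜ z@(a +i b) z#0 = mk≈
    (≈ᴿ-trans
      (pointwise λ n → solve 3 (λ a b r →
          a :* (a :* r) :+ :- (b :* (:- b :* r)) := (a :* a :+ b :* b) :* r)
        refl (seq a n) (seq b n) (seq r n))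
      (*-recipᴿ (norm² z) (norm²#0 z z#0)))
    (pointwise λ n → solve 3 (λ a b r →
          a :* (:- b :* r) :+ b :* (a :* r) := con 0ℚ)
        refl (seq a n) (seq b n) (seq r n))
    where r = recipᴿ (norm² z) (norm²#0 z z#0)

  #0ᶜ⇒invertible : ∀ {z} → z #0ᶜ → Invertible _≈ᶜ_ 1ᶜ _*ᶜ_ z
  #0ᶜ⇒invertible {z} z#0 =
    recipᶜ z z#0 , ℂR.trans (*ᶜ-comm (recipᶜ z z#0) z) (*-recipᶜ z z#0) , *-recipᶜ z z#0

  invertible⇒#0ᶜ : ∀ {z} → Invertible _≈ᶜ_ 1ᶜ _*ᶜ_ z → z #0ᶜ
  invertible⇒#0ᶜ (_ , _ , mk≈ eq _) =
    [ (λ p → inj₁ (#0ᴿ-factorˡ p)) , (λ p → inj₂ (#0ᴿ-factorˡ (#0ᴿ-neg p))) ]′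
      (#0ᴿ-split (#0ᴿ-resp (≈ᴿ-sym eq) 1#0ᴿ))

ℂ-heytingField : HeytingField 0ℓ 0ℓ 0ℓ
ℂ-heytingField = mkHeytingField ℂ-commutativeRing _#0ᶜ
  (λ { (mk≈ p q) → [ (λ r → inj₁ (#0ᴿ-resp p r)) , (λ r → inj₂ (#0ᴿ-resp q r)) ]′ })
  #0ᶜ-split
  (λ ¬z#0 → mk≈ (#0ᴿ-tight (λ p → ¬z#0 (inj₁ p))) (#0ᴿ-tight (λ p → ¬z#0 (inj₂ p))))
  [ ¬0#0ᴿ , ¬0#0ᴿ ]′
  #0ᶜ⇒invertible
  invertible⇒#0ᶜ

infix 4 _#ᴿ_
_#ᴿ_ : ℝ → ℝ → Set
_#ᴿ_ = HeytingField._#_ ℝ-heytingField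

infix 4 _#ᶜ_
_#ᶜ_ : ℂ → ℂ → Set
_#ᶜ_ = HeytingField._#_ ℂ-heytingField

fromℝ-# : ∀ {x y} → x #ᴿ y → fromℝ x #ᶜ fromℝ y
fromℝ-# = inj₁

module _ {c ℓ₁ ℓ₂ : Level} (F : HeytingField c ℓ₁ ℓ₂) where
  open HeytingField F
  open import Algebra.Definitions.RawMonoid (CommutativeRing.+-rawMonoid (HeytingCommutativeRing.commutativeRing heytingCommutativeRing)) using () renaming (_×_ to _·_)

  numeral : ℕ → Carrier
  numeral n = n · 1#

  CharZero : Set ℓ₂
  CharZero = ∀ n .{{_ : ℕ.NonZero n}} → numeral n # 0#

private
  0≤numeral : ∀ n i → 0ℚ ℚ.≤ seq (re (numeral ℂ-heytingField n)) i
  0≤numeral zero    i = ℚ.≤-refl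
  0≤numeral (suc n) i = ℚ.+-mono-≤ (ℚ.nonNegative⁻¹ 1ℚ) (0≤numeral n i)

ℂ-charZero : CharZero ℂ-heytingField
ℂ-charZero (suc n) = inj₁ (mk#0 1ℚ (ℚ.positive⁻¹ 1ℚ) 0 λ i _ →
  let a = seq (re (numeral ℂ-heytingField n)) i
      1≤1+a = subst (ℚ._≤ 1ℚ ℚ.+ a) (ℚ.+-identityʳ 1ℚ) (ℚ.+-monoʳ-≤ 1ℚ (0≤numeral n i))
  in subst (λ p → 1ℚ ℚ.≤ ∣ p ∣) (sym (ℚ.+-identityʳ (1ℚ ℚ.+ a)))
       (subst (1ℚ ℚ.≤_)
         (sym (ℚ.0≤p⇒∣p∣≡p (ℚ.≤-trans (ℚ.nonNegative⁻¹ 1ℚ) 1≤1+a))) 1≤1+a))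

open import Data.Integer.Base using (ℤ; +_; -[1+_])

-- The parameter λ is written l, since λ is reserved.
module Degenerate {c ℓ₁ ℓ₂ : Level} (F : HeytingField c ℓ₁ ℓ₂) (charZero : CharZero F) where
  open HeytingField F hiding (refl; sym; trans)
  private
    commutativeRing : CommutativeRing c ℓ₁
    commutativeRing = HeytingCommutativeRing.commutativeRing heytingCommutativeRing
  open import Algebra.Definitions.RawSemiring (Semiring.rawSemiring (CommutativeRing.semiring commutativeRing)) using (_^_; sum)

  fromℕ : ℕ → Carrier
  fromℕ = numeral F

  recip : (z : Carrier) → z # 0# → Carrier
  recip z z#0 = proj₁ (#⇒invertible z#0)

  1/ℕ : (n : ℕ) .{{_ : ℕ.NonZero n}} → Carrier
  1/ℕ n = recip (fromℕ n) (charZero n)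

  1/! : ℕ → Carrier
  1/! n = 1/ℕ (n !) {{n !≢0}}

  -- 1 / n ^ k for an integer exponent k
  1/ℕ^ : (n : ℕ) .{{_ : ℕ.NonZero n}} → ℤ → Carrier
  1/ℕ^ n (+ m)    = 1/ℕ n ^ m
  1/ℕ^ n -[1+ m ] = fromℕ n ^ suc m

  ∑< : ℕ → (ℕ → Carrier) → Carrier
  ∑< n f = sum {n} λ i → f (toℕ i)

  infixl 10 ∑<
  syntax ∑< n (λ i → a) = ∑[ i < n ] a

  -- A formal power series in t; f n is the coefficient of t ^ n.
  Series : Set c
  Series = ℕ → Carrier

  infixl 6 _⊖_
  infixl 7 _⊛_ _⊘_[_]
  infixr 7 _·_
  infixr 8 _^ˢ_

  const : Carrier → Series
  const a zero    = a
  const a (suc n) = 0#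

  _·_ : Carrier → Series → Series
  (a · f) n = a * f n

  _⊖_ : Series → Series → Series
  (f ⊖ g) n = f n - g n

  _⊛_ : Series → Series → Series
  (f ⊛ g) n = ∑[ i < suc n ] (f i * g (n ∸ i))

  _^ˢ_ : Series → ℕ → Series
  f ^ˢ zero  = const 1#
  f ^ˢ suc n = f ⊛ f ^ˢ n

  -- f(g(t)), for g with zero constant term: then g ^ j contributes nothing to the
  -- coefficient of t ^ n when j > n.
  _∘ˢ_ : Series → Series → Series
  (f ∘ˢ g) n = ∑[ j < suc n ] (f j * (g ^ˢ j) n)

  -- Long division: f / g = q + t (f₁ / g), where q = f 0 / g 0 and t f₁ = f - q g.
  _⊘_[_] : (f g : Series) → g 0 # 0# → Series
  (f ⊘ g [ g₀#0 ]) zero    = f 0 * recip (g 0) g₀#0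
  (f ⊘ g [ g₀#0 ]) (suc n) = (f₁ ⊘ g [ g₀#0 ]) n
    where
    f₁ : Series
    f₁ m = f (suc m) - (f 0 * recip (g 0) g₀#0) * g (suc m)

  -- a 0 + a 1 t + a 2 t² / 2! + ⋯
  egf : (ℕ → Carrier) → Series
  egf a n = a n * 1/! n

  -- ⟨ z ⟩[ n , l ] = z (z - l) ⋯ (z - (n - 1) l)
  ⟨_⟩[_,_] : Carrier → ℕ → Carrier → Carrier
  ⟨ z ⟩[ zero  , l ] = 1#
  ⟨ z ⟩[ suc n , l ] = ⟨ z ⟩[ n , l ] * (z - fromℕ n * l)

  -- The binomial series (1 + t) ^ a.
  [1+t]^ : Carrier → Series
  [1+t]^ a = egf λ n → ⟨ a ⟩[ n , 1# ]

  module _ (l : Carrier) (l#0 : l # 0#) where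

    -- (1 + l t) ^ (z / l), the binomial series evaluated at l t
    e^ : Carrier → Series
    e^ z n = [1+t]^ (z * recip l l#0) n * l ^ n

    log[1+t] : Series
    log[1+t] = recip l l#0 · ([1+t]^ l ⊖ const 1#)

    -- (log[1+t]) ^ j / j! is the exponential generating function of S₁ n j.
    S₁ : ℕ → ℕ → Carrier
    S₁ n j = fromℕ (n !) * (1/! j · log[1+t] ^ˢ j) n

    -- ∑ over n ≥ 1 of ⟨ 1 ⟩[ n , l ] tⁿ / (n ^ k (n - 1)!)
    Ei : ℤ → Series
    Ei k zero    = 0#
    Ei k (suc n) = ⟨ 1# ⟩[ suc n , l ] * (1/ℕ^ (suc n) k * 1/! n)

    module _ (k : ℤ) (u : Carrier) (u#1 : u # 1#) where
      private
        module R = CommutativeRing commutativeRing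
        open import Algebra.Apartness.Properties.HeytingCommutativeRing heytingCommutativeRing using (#-congʳ; #-congˡ; x-0≈x)
        open import Relation.Binary.Reasoning.Setoid R.setoid

        1/!0≈1 : 1/! 0 ≈ 1#
        1/!0≈1 = begin
          1/! 0                    ≈⟨ R.*-identityʳ (1/! 0) ⟨
          1/! 0 * 1#               ≈⟨ R.*-congˡ (R.trans (x-0≈x _) (R.+-identityʳ 1#)) ⟨
          1/! 0 * (fromℕ 1 - 0#)   ≈⟨ proj₁ (proj₂ (#⇒invertible (charZero 1))) ⟩
          1#                       ∎

        e₀≈1 : e^ 1# 0 ≈ 1#
        e₀≈1 = R.trans (R.*-identityʳ _) (R.trans (R.*-identityˡ _) 1/!0≈1)

        denominator₀#0 : (e^ 1# ⊖ const u) 0 # 0#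
        denominator₀#0 = invertible⇒# (1-u⁻¹ (#⇒invertible (#-sym (#-congˡ (R.sym e₀≈1) u#1))))
          where
          1-u⁻¹ : ∀ {z} → Invertible _≈_ 1# _*_ z → Invertible _≈_ 1# _*_ (z - 0#)
          1-u⁻¹ (w , wz , zw) =
            w , R.trans (R.*-congˡ (x-0≈x _)) wz , R.trans (R.*-congʳ (x-0≈x _)) zw

      FG-series : Carrier → Series
      FG-series x = (((1# - u) · (Ei k ∘ˢ log[1+t])) ⊘ (e^ 1# ⊖ const u) [ denominator₀#0 ]) ⊛ e^ x

      -- FG-series x is the exponential generating function of FG x n.
      FG : Carrier → ℕ → Carrier
      FG x n = fromℕ (n !) * FG-series x n

open Degenerate ℂ-heytingField ℂ-charZero public
open HeytingField ℂ-heytingField public using (_≈_; _+_; _*_; _-_)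

{-# OPTIONS --safe #-}

-- Multiplying an exponential generating function by another is binomial convolution of
-- the coefficients, so the left-hand side is n! times the coefficient of tⁿ in
-- F(t) (e(t) - u), where F is the generating function of FG. Since F is defined with the
-- denominator e(t) - u, this product is (1 - u) Ei(log(1 + t)) eˣ(t). The series
-- Ei(log(1 + t)) has no constant term, and its coefficient of t ^ (m + 1), multiplied by
-- (m + 1)!, is the inner sum on the right; dropping one power of t accounts for the
-- factor n and for the binomial coefficients of n - 1.
module Submission where

import Defs
open import Algebra.Apartness.Bundles using (HeytingCommutativeRing; HeytingField)
open import Algebra.Bundles using (CommutativeRing; Semiring)
open import Data.Fin.Base using (toℕ)
open import Data.Fin.Properties using (toℕ<n)
open import Data.Integer.Base as ℤ using (ℤ; 1ℤ; +_; -[1+_])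
open import Data.Nat.Base as ℕ using (ℕ; zero; suc; _∸_; _!; _<_; _≤_; s≤s⁻¹)
open import Data.Nat.Combinatorics using (_C_; nCk≡n!/k![n-k]!; k![n∸k]!∣n!)
open import Data.Nat.DivMod using (m/n*n≡m)
import Data.Nat.Properties as ℕ
open import Data.Product.Base using (proj₁; proj₂)
open import Relation.Binary.PropositionalEquality as ≡ using (_≡_)

-- Binomial coefficients and factorials.

nCm*[m!*[n∸m]!]≡n! : ∀ {m n} → m ≤ n → (n C m) ℕ.* (m ! ℕ.* (n ∸ m) !) ≡ n !
nCm*[m!*[n∸m]!]≡n! {m} {n} m≤n =
  ≡.trans (≡.cong (ℕ._* (m ! ℕ.* (n ∸ m) !)) (nCk≡n!/k![n-k]! m≤n)) (m/n*n≡m (k![n∸k]!∣n! m≤n))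
  where instance _ = m ℕ.!* (n ∸ m) !≢0

-- The argument is purely algebraic: it runs over any Heyting field of characteristic zero and is
-- specialised to the complex numbers at the end.
module DegenerateProperties {c ℓ₁ ℓ₂} (F : HeytingField c ℓ₁ ℓ₂) (charZero : Defs.CharZero F) where
  open HeytingField F using (_#_; #⇒invertible; heytingCommutativeRing)
  open CommutativeRing (HeytingCommutativeRing.commutativeRing heytingCommutativeRing) hiding (zero)
  open Defs.Degenerate F charZero
  open import Algebra.Apartness.Properties.HeytingCommutativeRing heytingCommutativeRing using (x-0≈x)
  open import Algebra.Definitions.RawSemiring (Semiring.rawSemiring semiring) using (_^_)
  open import Algebra.Properties.Ring ring using ([y-z]x≈yx-zx; x[y-z]≈xy-xz)
  open import Algebra.Properties.Semiring.Mult semiring using (×1-homo-*)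
  open import Algebra.Properties.Semiring.Sum semiring using (sum-cong-≋; *-distribˡ-sum)
  open import Algebra.Solver.Ring.NaturalCoefficients.Default commutativeSemiring using (solve; con; _:=_; _:+_; _:*_)
  open import Relation.Binary.Reasoning.Setoid setoid

  fromℕ-* : ∀ m n → fromℕ (m ℕ.* n) ≈ fromℕ m * fromℕ n
  fromℕ-* = ×1-homo-*

  recip-inverseˡ : ∀ z (z#0 : z # 0#) → recip z z#0 * z ≈ 1#
  recip-inverseˡ z z#0 = trans (*-congˡ (sym (x-0≈x z))) (proj₁ (proj₂ (#⇒invertible z#0)))

  1/ℕ-inverseˡ : ∀ n .{{_ : ℕ.NonZero n}} → 1/ℕ n * fromℕ n ≈ 1#
  1/ℕ-inverseˡ n = recip-inverseˡ (fromℕ n) (charZero n)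

  1/!-inverseˡ : ∀ n → 1/! n * fromℕ (n !) ≈ 1#
  1/!-inverseˡ n = 1/ℕ-inverseˡ (n !) {{n ℕ.!≢0}}

  -- Uniqueness of inverses: multiplied by `fromℕ (n !)`, either side gives 1.
  1/!-suc : ∀ n → 1/! (suc n) * fromℕ (suc n) ≈ 1/! n
  1/!-suc n = begin
    1/! (suc n) * fromℕ (suc n)                              ≈⟨ *-identityʳ _ ⟨
    1/! (suc n) * fromℕ (suc n) * 1#                         ≈⟨ *-congˡ (1/!-inverseˡ n) ⟨
    1/! (suc n) * fromℕ (suc n) * (1/! n * fromℕ (n !))
      ≈⟨ solve 4 (λ a b c d → a :* b :* (c :* d) := a :* (b :* d) :* c) refl
           (1/! (suc n)) (fromℕ (suc n)) (1/! n) (fromℕ (n !)) ⟩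
    1/! (suc n) * (fromℕ (suc n) * fromℕ (n !)) * 1/! n      ≈⟨ *-congʳ (*-congˡ (fromℕ-* (suc n) (n !))) ⟨
    1/! (suc n) * fromℕ (suc n !) * 1/! n                    ≈⟨ *-congʳ (1/!-inverseˡ (suc n)) ⟩
    1# * 1/! n                                               ≈⟨ *-identityˡ _ ⟩
    1/! n                                                    ∎

  fromℕ-C : ∀ {m n} → m ≤ n → fromℕ (n C m) ≈ fromℕ (n !) * (1/! m * 1/! (n ∸ m))
  fromℕ-C {m} {n} m≤n = begin
    fromℕ (n C m)                                            ≈⟨ *-identityʳ _ ⟨
    fromℕ (n C m) * 1#                                       ≈⟨ *-congˡ (*-identityʳ 1#) ⟨
    fromℕ (n C m) * (1# * 1#)
      ≈⟨ *-congˡ (*-cong (1/!-inverseˡ m) (1/!-inverseˡ (n ∸ m))) ⟨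
    fromℕ (n C m) * (1/! m * fromℕ (m !) * (1/! (n ∸ m) * fromℕ ((n ∸ m) !)))
      ≈⟨ solve 5 (λ a b c d e → a :* (b :* c :* (d :* e)) := a :* (c :* e) :* (b :* d)) refl
           (fromℕ (n C m)) (1/! m) (fromℕ (m !)) (1/! (n ∸ m)) (fromℕ ((n ∸ m) !)) ⟩
    fromℕ (n C m) * (fromℕ (m !) * fromℕ ((n ∸ m) !)) * (1/! m * 1/! (n ∸ m))
      ≈⟨ *-congʳ (trans (fromℕ-* (n C m) _) (*-congˡ (fromℕ-* (m !) _))) ⟨
    fromℕ ((n C m) ℕ.* (m ! ℕ.* (n ∸ m) !)) * (1/! m * 1/! (n ∸ m))
      ≈⟨ *-congʳ (reflexive (≡.cong fromℕ (nCm*[m!*[n∸m]!]≡n! m≤n))) ⟩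
    fromℕ (n !) * (1/! m * 1/! (n ∸ m))                      ∎

  -- Bridges the exponent `k - 1` of the theorem and the exponent `k` of `Ei`. The cases follow the
  -- sign split in `1/ℕ^`; at `k = 0` the predecessor crosses to the negative branch.
  1/ℕ^-pred : ∀ n .{{_ : ℕ.NonZero n}} k → 1/ℕ^ n (k ℤ.- 1ℤ) ≈ fromℕ n * 1/ℕ^ n k
  1/ℕ^-pred n (+ zero)  = refl
  1/ℕ^-pred n (+ suc m) = begin
    1/ℕ n ^ m                        ≈⟨ *-identityˡ _ ⟨
    1# * 1/ℕ n ^ m                   ≈⟨ *-congʳ (trans (*-comm _ _) (1/ℕ-inverseˡ n)) ⟨
    fromℕ n * 1/ℕ n * 1/ℕ n ^ m      ≈⟨ *-assoc _ _ _ ⟩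
    fromℕ n * (1/ℕ n * 1/ℕ n ^ m)    ∎
  1/ℕ^-pred n -[1+ m ]  = reflexive (≡.cong (λ i → fromℕ n * (fromℕ n * fromℕ n ^ i)) (ℕ.+-identityʳ m))

  -- Finite sums and the algebra of formal power series.

  ∑-cong : ∀ n {f g : ℕ → Carrier} → (∀ i → i < n → f i ≈ g i) → ∑< n f ≈ ∑< n g
  ∑-cong n f≈g = sum-cong-≋ {n} λ i → f≈g (toℕ i) (toℕ<n i)

  *-distribˡ-∑ : ∀ n a (f : ℕ → Carrier) → a * ∑< n f ≈ ∑[ i < n ] (a * f i)
  *-distribˡ-∑ n a f = *-distribˡ-sum {n} a λ i → f (toℕ i)

  infix 4 _≋_
  _≋_ : Series → Series → Set ℓ₁
  f ≋ g = ∀ n → f n ≈ g n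

  -- The series `(f - f 0) / t`. By definition `(f ⊛ g) (suc n)` unfolds to
  -- `f 0 * g (suc n) + (tail f ⊛ g) n`, which drives the inductions on coefficients below.
  tail : Series → Series
  tail f n = f (suc n)

  infixl 6 _⊕_
  _⊕_ : Series → Series → Series
  (f ⊕ g) n = f n + g n

  ⊛-cong : ∀ {f f′ g g′} → f ≋ f′ → g ≋ g′ → f ⊛ g ≋ f′ ⊛ g′
  ⊛-cong f≋f′ g≋g′ n = ∑-cong (suc n) λ i _ → *-cong (f≋f′ i) (g≋g′ (n ∸ i))

  ⊛-distribʳ-⊕ : ∀ f g h → (f ⊕ g) ⊛ h ≋ f ⊛ h ⊕ g ⊛ h
  ⊛-distribʳ-⊕ f g h zero    = solve 3
    (λ a b c → (a :+ b) :* c :+ con 0 := (a :* c :+ con 0) :+ (b :* c :+ con 0)) refl (f 0) (g 0) (h 0)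
  ⊛-distribʳ-⊕ f g h (suc n) = begin
    (f 0 + g 0) * h (suc n) + ((tail f ⊕ tail g) ⊛ h) n
      ≈⟨ +-congˡ (⊛-distribʳ-⊕ (tail f) (tail g) h n) ⟩
    (f 0 + g 0) * h (suc n) + ((tail f ⊛ h) n + (tail g ⊛ h) n)
      ≈⟨ solve 5 (λ a b c d e → (a :+ b) :* c :+ (d :+ e) := (a :* c :+ d) :+ (b :* c :+ e)) refl
           (f 0) (g 0) (h (suc n)) ((tail f ⊛ h) n) ((tail g ⊛ h) n) ⟩
    (f ⊛ h ⊕ g ⊛ h) (suc n) ∎

  ·-⊛-assoc : ∀ a f g → (a · f) ⊛ g ≋ a · (f ⊛ g)
  ·-⊛-assoc a f g n = trans (∑-cong (suc n) λ i _ → *-assoc a (f i) (g (n ∸ i)))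
                            (sym (*-distribˡ-∑ (suc n) a λ i → f i * g (n ∸ i)))

  -- The definition peels off the first term of a convolution; commutativity also needs the last one
  -- peeled off.
  ⊛-suc-last : ∀ f g n → (f ⊛ g) (suc n) ≈ (f ⊛ tail g) n + f (suc n) * g 0
  ⊛-suc-last f g zero    = trans (sym (+-assoc _ _ _)) (trans (+-identityʳ _) (+-congʳ (sym (+-identityʳ _))))
  ⊛-suc-last f g (suc n) = trans (+-congˡ (⊛-suc-last (tail f) g n)) (sym (+-assoc _ _ _))

  ⊛-comm : ∀ f g → f ⊛ g ≋ g ⊛ f
  ⊛-comm f g zero    = +-congʳ (*-comm (f 0) (g 0))
  ⊛-comm f g (suc n) = begin
    f 0 * g (suc n) + (tail f ⊛ g) n  ≈⟨ +-cong (*-comm _ _) (⊛-comm (tail f) g n) ⟩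
    g (suc n) * f 0 + (g ⊛ tail f) n  ≈⟨ +-comm _ _ ⟩
    (g ⊛ tail f) n + g (suc n) * f 0  ≈⟨ ⊛-suc-last g f n ⟨
    (g ⊛ f) (suc n)                   ∎

  ⊛-assoc : ∀ f g h → (f ⊛ g) ⊛ h ≋ f ⊛ (g ⊛ h)
  ⊛-assoc f g h zero    = +-congʳ (begin
    (f 0 * g 0 + 0#) * h 0    ≈⟨ *-congʳ (+-identityʳ _) ⟩
    f 0 * g 0 * h 0           ≈⟨ *-assoc _ _ _ ⟩
    f 0 * (g 0 * h 0)         ≈⟨ *-congˡ (+-identityʳ _) ⟨
    f 0 * (g 0 * h 0 + 0#)    ∎)
  ⊛-assoc f g h (suc n) = begin
    -- Here `tail (f ⊛ g)` has unfolded to `f 0 · tail g ⊕ tail f ⊛ g`.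
    (f 0 * g 0 + 0#) * h (suc n) + ((f 0 · tail g ⊕ tail f ⊛ g) ⊛ h) n
      ≈⟨ +-cong (*-congʳ (+-identityʳ _)) (⊛-distribʳ-⊕ (f 0 · tail g) (tail f ⊛ g) h n) ⟩
    f 0 * g 0 * h (suc n) + (((f 0 · tail g) ⊛ h) n + ((tail f ⊛ g) ⊛ h) n)
      ≈⟨ +-congˡ (+-cong (·-⊛-assoc (f 0) (tail g) h n) (⊛-assoc (tail f) g h n)) ⟩
    f 0 * g 0 * h (suc n) + (f 0 * (tail g ⊛ h) n + (tail f ⊛ (g ⊛ h)) n)
      ≈⟨ solve 5 (λ a b c d e → a :* b :* c :+ (a :* d :+ e) := a :* (b :* c :+ d) :+ e) refl
           (f 0) (g 0) (h (suc n)) ((tail g ⊛ h) n) ((tail f ⊛ (g ⊛ h)) n) ⟩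
    (f ⊛ (g ⊛ h)) (suc n) ∎

  -- Turns multiplication by the denominator `e(t) - u` into the difference on the left of the
  -- theorem. The constant `u` meets only the last term of the convolution, so the induction carries
  -- it to coefficient 0.
  ⊛-[-const] : ∀ f g u → f ⊛ (g ⊖ const u) ≋ f ⊛ g ⊖ u · f
  ⊛-[-const] f g u zero    = begin
    f 0 * (g 0 - u) + 0#              ≈⟨ +-identityʳ _ ⟩
    f 0 * (g 0 - u)                   ≈⟨ x[y-z]≈xy-xz _ _ _ ⟩
    f 0 * g 0 - f 0 * u               ≈⟨ +-cong (sym (+-identityʳ _)) (-‿cong (*-comm _ _)) ⟩
    (f 0 * g 0 + 0#) - u * f 0        ∎
  ⊛-[-const] f g u (suc n) = begin
    f 0 * (g (suc n) - 0#) + (tail f ⊛ (g ⊖ const u)) n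
      ≈⟨ +-cong (*-congˡ (x-0≈x _)) (⊛-[-const] (tail f) g u n) ⟩
    f 0 * g (suc n) + ((tail f ⊛ g) n - u * f (suc n))
      ≈⟨ +-assoc _ _ _ ⟨
    (f ⊛ g) (suc n) - u * f (suc n) ∎

  -- Follows the long division: the tail of the quotient is the quotient of the remainder `f₁`, so
  -- the induction hypothesis is applied to `f₁` instead of `f`.
  ⊘-⊛-cancel : ∀ f g (g₀#0 : g 0 # 0#) → (f ⊘ g [ g₀#0 ]) ⊛ g ≋ f
  ⊘-⊛-cancel f g g₀#0 zero    = begin
    f 0 * recip (g 0) g₀#0 * g 0 + 0#    ≈⟨ +-identityʳ _ ⟩
    f 0 * recip (g 0) g₀#0 * g 0         ≈⟨ *-assoc _ _ _ ⟩
    f 0 * (recip (g 0) g₀#0 * g 0)       ≈⟨ *-congˡ (recip-inverseˡ (g 0) g₀#0) ⟩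
    f 0 * 1#                             ≈⟨ *-identityʳ _ ⟩
    f 0                                  ∎
  ⊘-⊛-cancel f g g₀#0 (suc n) = begin
    q * g (suc n) + ((f₁ ⊘ g [ g₀#0 ]) ⊛ g) n      ≈⟨ +-congˡ (⊘-⊛-cancel f₁ g g₀#0 n) ⟩
    q * g (suc n) + (f (suc n) - q * g (suc n))    ≈⟨ +-comm _ _ ⟩
    f (suc n) - q * g (suc n) + q * g (suc n)      ≈⟨ +-assoc _ _ _ ⟩
    f (suc n) + (- (q * g (suc n)) + q * g (suc n))  ≈⟨ +-congˡ (-‿inverseˡ _) ⟩
    f (suc n) + 0#                                 ≈⟨ +-identityʳ _ ⟩
    f (suc n)                                      ∎
    where
    q : Carrier
    q = f 0 * recip (g 0) g₀#0
    f₁ : Series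
    f₁ m = f (suc m) - q * g (suc m)

  -- Exponential generating functions.

  egf-n!* : ∀ f → egf (λ n → fromℕ (n !) * f n) ≋ f
  egf-n!* f n = begin
    fromℕ (n !) * f n * 1/! n      ≈⟨ solve 3 (λ a b c → a :* b :* c := c :* a :* b) refl (fromℕ (n !)) (f n) (1/! n) ⟩
    1/! n * fromℕ (n !) * f n      ≈⟨ *-congʳ (1/!-inverseˡ n) ⟩
    1# * f n                       ≈⟨ *-identityˡ _ ⟩
    f n                            ∎

  egf-⊛ : ∀ a b n → ∑[ m < suc n ] (fromℕ (n C m) * a m * b (n ∸ m)) ≈ fromℕ (n !) * (egf a ⊛ egf b) n
  egf-⊛ a b n = trans
    (∑-cong (suc n) λ m m<1+n → begin
      fromℕ (n C m) * a m * b (n ∸ m)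
        -- The factor `n!` will leave the sum; the two reciprocal factorials go one to each
        -- generating function.
        ≈⟨ *-congʳ (*-congʳ (fromℕ-C (s≤s⁻¹ m<1+n))) ⟩
      fromℕ (n !) * (1/! m * 1/! (n ∸ m)) * a m * b (n ∸ m)
        ≈⟨ solve 5 (λ N r s x y → N :* (r :* s) :* x :* y := N :* (x :* r :* (y :* s))) refl
             (fromℕ (n !)) (1/! m) (1/! (n ∸ m)) (a m) (b (n ∸ m)) ⟩
      fromℕ (n !) * (egf a m * egf b (n ∸ m)) ∎)
    (sym (*-distribˡ-∑ (suc n) (fromℕ (n !)) λ m → egf a m * egf b (n ∸ m)))

  module _ (l : Carrier) (l#0 : l # 0#) where

    -- The degenerate exponential.

    -- Each of the `n` factors `z / l - i` absorbs one `l` and becomes `z - i l`.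
    ⟨⟩-scale : ∀ z n → ⟨ z * recip l l#0 ⟩[ n , 1# ] * l ^ n ≈ ⟨ z ⟩[ n , l ]
    ⟨⟩-scale z zero    = *-identityʳ 1#
    ⟨⟩-scale z (suc n) = begin
      ⟨ z * r ⟩[ n , 1# ] * (z * r - fromℕ n * 1#) * (l * l ^ n)
        ≈⟨ solve 4 (λ p w a b → p :* w :* (a :* b) := p :* b :* (w :* a)) refl
             ⟨ z * r ⟩[ n , 1# ] (z * r - fromℕ n * 1#) l (l ^ n) ⟩
      ⟨ z * r ⟩[ n , 1# ] * l ^ n * ((z * r - fromℕ n * 1#) * l)
        ≈⟨ *-cong (⟨⟩-scale z n) factor ⟩
      ⟨ z ⟩[ n , l ] * (z - fromℕ n * l) ∎
      where
      r : Carrier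
      r = recip l l#0
      factor : (z * r - fromℕ n * 1#) * l ≈ z - fromℕ n * l
      factor = begin
        (z * r - fromℕ n * 1#) * l        ≈⟨ [y-z]x≈yx-zx _ _ _ ⟩
        z * r * l - fromℕ n * 1# * l      ≈⟨ +-cong (*-assoc _ _ _) (-‿cong (*-congʳ (*-identityʳ _))) ⟩
        z * (r * l) - fromℕ n * l         ≈⟨ +-congʳ (trans (*-congˡ (recip-inverseˡ l l#0)) (*-identityʳ z)) ⟩
        z - fromℕ n * l                   ∎

    e^-egf : ∀ z → e^ l l#0 z ≋ egf (λ n → ⟨ z ⟩[ n , l ])
    e^-egf z n = begin
      ⟨ z * recip l l#0 ⟩[ n , 1# ] * 1/! n * l ^ n
        ≈⟨ solve 3 (λ p a b → p :* a :* b := p :* b :* a) refl ⟨ z * recip l l#0 ⟩[ n , 1# ] (1/! n) (l ^ n) ⟩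
      ⟨ z * recip l l#0 ⟩[ n , 1# ] * l ^ n * 1/! n
        ≈⟨ *-congʳ (⟨⟩-scale z n) ⟩
      ⟨ z ⟩[ n , l ] * 1/! n ∎

    module _ (k : ℤ) where

      -- The composite `Ei(log(1 + t))` and Stirling numbers.

      Ei∘log : Series
      Ei∘log = Ei l l#0 k ∘ˢ log[1+t] l l#0

      Ei∘log-zero : Ei∘log 0 ≈ 0#
      Ei∘log-zero = trans (+-identityʳ _) (zeroˡ _)

      -- The inner sum of the theorem, with its index shifted to start at 0.
      stirlingSum : ℕ → Carrier
      stirlingSum m = ∑[ j < suc m ] (⟨ 1# ⟩[ suc j , l ] * 1/ℕ^ (suc j) (k ℤ.- 1ℤ) * S₁ l l#0 (suc m) (suc j))

      -- Holds term by term: the factor `j + 1` gained by lowering the exponent to `k - 1` reduces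
      -- the `1/(j + 1)!` inside `S₁` to the `1/j!` of `Ei`.
      Ei∘log-suc : ∀ m → stirlingSum m ≈ fromℕ (suc m !) * Ei∘log (suc m)
      Ei∘log-suc m = begin
        ∑[ j < suc m ] (⟨ 1# ⟩[ suc j , l ] * 1/ℕ^ (suc j) (k ℤ.- 1ℤ) * S₁ l l#0 (suc m) (suc j))
          ≈⟨ ∑-cong (suc m) (λ j _ → term j) ⟩
        ∑[ j < suc m ] (fromℕ (suc m !) * (Ei l l#0 k (suc j) * L j))
          ≈⟨ *-distribˡ-∑ (suc m) (fromℕ (suc m !)) (λ j → Ei l l#0 k (suc j) * L j) ⟨
        fromℕ (suc m !) * ∑[ j < suc m ] (Ei l l#0 k (suc j) * L j)
          -- The composite also has a term for the zeroth power of the logarithm, with coefficient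
          -- `Ei k 0 = 0`.
          ≈⟨ *-congˡ (trans (+-congʳ (zeroˡ _)) (+-identityˡ _)) ⟨
        fromℕ (suc m !) * Ei∘log (suc m) ∎
        where
        L : ℕ → Carrier
        L j = (log[1+t] l l#0 ^ˢ suc j) (suc m)
        term : ∀ j → ⟨ 1# ⟩[ suc j , l ] * 1/ℕ^ (suc j) (k ℤ.- 1ℤ) * S₁ l l#0 (suc m) (suc j)
                       ≈ fromℕ (suc m !) * (Ei l l#0 k (suc j) * L j)
        term j = begin
          ⟨ 1# ⟩[ suc j , l ] * 1/ℕ^ (suc j) (k ℤ.- 1ℤ) * (fromℕ (suc m !) * (1/! (suc j) * L j))
            ≈⟨ *-congʳ (*-congˡ (1/ℕ^-pred (suc j) k)) ⟩
          ⟨ 1# ⟩[ suc j , l ] * (fromℕ (suc j) * 1/ℕ^ (suc j) k) * (fromℕ (suc m !) * (1/! (suc j) * L j))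
            ≈⟨ solve 6 (λ p a b M d x → p :* (a :* b) :* (M :* (d :* x)) := M :* (p :* (b :* (d :* a)) :* x)) refl
                 ⟨ 1# ⟩[ suc j , l ] (fromℕ (suc j)) (1/ℕ^ (suc j) k) (fromℕ (suc m !)) (1/! (suc j)) (L j) ⟩
          fromℕ (suc m !) * (⟨ 1# ⟩[ suc j , l ] * (1/ℕ^ (suc j) k * (1/! (suc j) * fromℕ (suc j))) * L j)
            ≈⟨ *-congˡ (*-congʳ (*-congˡ (*-congˡ (1/!-suc j)))) ⟩
          fromℕ (suc m !) * (Ei l l#0 k (suc j) * L j) ∎

      -- Dividing by `m + 1` turns the weight `(m + 1)!` of `Ei∘log-suc` into the weight `m!` that
      -- the shifted series requires.
      tail-Ei∘log : egf (λ m → 1/ℕ (suc m) * stirlingSum m) ≋ tail Ei∘log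
      tail-Ei∘log m = begin
        1/ℕ (suc m) * stirlingSum m * 1/! m
          ≈⟨ *-congʳ (*-congˡ (trans (Ei∘log-suc m) (*-congʳ (fromℕ-* (suc m) (m !))))) ⟩
        1/ℕ (suc m) * (fromℕ (suc m) * fromℕ (m !) * Ei∘log (suc m)) * 1/! m
          ≈⟨ solve 5 (λ a b c d e → a :* (b :* c :* d) :* e := a :* b :* (c :* d :* e)) refl
               (1/ℕ (suc m)) (fromℕ (suc m)) (fromℕ (m !)) (Ei∘log (suc m)) (1/! m) ⟩
        1/ℕ (suc m) * fromℕ (suc m) * (fromℕ (m !) * Ei∘log (suc m) * 1/! m)
          ≈⟨ *-cong (1/ℕ-inverseˡ (suc m)) (egf-n!* (tail Ei∘log) m) ⟩
        1# * Ei∘log (suc m)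
          ≈⟨ *-identityˡ _ ⟩
        Ei∘log (suc m) ∎

      Ei∘log-⊛-e^ : ∀ x n →
        fromℕ n * ∑[ m < n ] (fromℕ ((n ∸ 1) C m) * 1/ℕ (suc m) * stirlingSum m * ⟨ x ⟩[ n ∸ 1 ∸ m , l ])
          ≈ fromℕ (n !) * (Ei∘log ⊛ e^ l l#0 x) n
      Ei∘log-⊛-e^ x zero    = begin
        -- For `n = 0` the sum is empty, and the product on the right has no constant term.
        0# * 0#                                     ≈⟨ zeroˡ _ ⟩
        0#                                          ≈⟨ zeroʳ _ ⟨
        fromℕ 1 * 0#
          ≈⟨ *-congˡ (trans (+-identityʳ _) (trans (*-congʳ Ei∘log-zero) (zeroˡ _))) ⟨
        fromℕ 1 * (Ei∘log ⊛ e^ l l#0 x) 0           ∎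
      Ei∘log-⊛-e^ x (suc p) = begin
        fromℕ (suc p) * ∑[ m < suc p ] (fromℕ (p C m) * 1/ℕ (suc m) * stirlingSum m * ⟨ x ⟩[ p ∸ m , l ])
          ≈⟨ *-congˡ (∑-cong (suc p) λ m _ → *-congʳ {⟨ x ⟩[ p ∸ m , l ]} (*-assoc (fromℕ (p C m)) (1/ℕ (suc m)) (stirlingSum m))) ⟩
        fromℕ (suc p) * ∑[ m < suc p ] (fromℕ (p C m) * (1/ℕ (suc m) * stirlingSum m) * ⟨ x ⟩[ p ∸ m , l ])
          ≈⟨ *-congˡ (egf-⊛ (λ m → 1/ℕ (suc m) * stirlingSum m) (λ m → ⟨ x ⟩[ m , l ]) p) ⟩
        fromℕ (suc p) * (fromℕ (p !) * (egf (λ m → 1/ℕ (suc m) * stirlingSum m) ⊛ egf (λ m → ⟨ x ⟩[ m , l ])) p)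
          ≈⟨ *-assoc _ _ _ ⟨
        fromℕ (suc p) * fromℕ (p !) * (egf (λ m → 1/ℕ (suc m) * stirlingSum m) ⊛ egf (λ m → ⟨ x ⟩[ m , l ])) p
          ≈⟨ *-cong (sym (fromℕ-* (suc p) (p !))) (⊛-cong tail-Ei∘log (λ m → sym (e^-egf x m)) p) ⟩
        fromℕ (suc p !) * (tail Ei∘log ⊛ e^ l l#0 x) p
          -- The first term of the convolution vanishes with the constant term of `Ei∘log`, leaving
          -- the tail one degree lower.
          ≈⟨ *-congˡ (trans (+-congʳ (trans (*-congʳ Ei∘log-zero) (zeroˡ _))) (+-identityˡ _)) ⟨
        fromℕ (suc p !) * (Ei∘log ⊛ e^ l l#0 x) (suc p) ∎

      module _ (u : Carrier) (u#1 : u # 1#) (x : Carrier) where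

        -- The generating function of `FG` and the recurrence.

        FGˢ : Series
        FGˢ = FG-series l l#0 k u u#1 x

        -- `FGˢ` is the quotient `Q` times `E`, so the denominator `D` is first moved past `E` to
        -- stand next to `Q`, where it cancels.
        FGˢ-⊛-denominator : FGˢ ⊛ (e^ l l#0 1# ⊖ const u) ≋ (1# - u) · (Ei∘log ⊛ e^ l l#0 x)
        FGˢ-⊛-denominator n = begin
          ((Q ⊛ E) ⊛ D) n               ≈⟨ ⊛-assoc Q E D n ⟩
          (Q ⊛ (E ⊛ D)) n               ≈⟨ ⊛-cong {Q} {Q} (λ _ → refl) (⊛-comm E D) n ⟩
          (Q ⊛ (D ⊛ E)) n               ≈⟨ ⊛-assoc Q D E n ⟨
          ((Q ⊛ D) ⊛ E) n               ≈⟨ ⊛-cong {g = E} {E} (⊘-⊛-cancel ((1# - u) · Ei∘log) D _) (λ _ → refl) n ⟩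
          (((1# - u) · Ei∘log) ⊛ E) n   ≈⟨ ·-⊛-assoc (1# - u) Ei∘log E n ⟩
          ((1# - u) · (Ei∘log ⊛ E)) n   ∎
          where
          E D Q : Series
          E = e^ l l#0 x
          D = e^ l l#0 1# ⊖ const u
          Q = ((1# - u) · Ei∘log) ⊘ D [ _ ]

        FG-recurrence : ∀ n →
          ∑[ m < suc n ] (fromℕ (n C m) * FG l l#0 k u u#1 x m * ⟨ 1# ⟩[ n ∸ m , l ]) - u * FG l l#0 k u u#1 x n
            ≈ (1# - u) * fromℕ n *
                ∑[ m < n ] (fromℕ ((n ∸ 1) C m) * 1/ℕ (suc m) * stirlingSum m * ⟨ x ⟩[ n ∸ 1 ∸ m , l ])
        FG-recurrence n = begin
          ∑[ m < suc n ] (fromℕ (n C m) * FG l l#0 k u u#1 x m * ⟨ 1# ⟩[ n ∸ m , l ]) - u * (N * FGˢ n)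
            ≈⟨ +-cong (egf-⊛ (FG l l#0 k u u#1 x) (λ m → ⟨ 1# ⟩[ m , l ]) n)
                 -- Moves `n!` to the front of the subtracted term as well, so that it factors out
                 -- of the whole difference.
                 (-‿cong (solve 3 (λ a b c → a :* (b :* c) := b :* (a :* c)) refl u N (FGˢ n))) ⟩
          N * (egf (FG l l#0 k u u#1 x) ⊛ egf (λ m → ⟨ 1# ⟩[ m , l ])) n - N * (u * FGˢ n)
            ≈⟨ +-congʳ (*-congˡ (⊛-cong (egf-n!* FGˢ) (λ m → sym (e^-egf 1# m)) n)) ⟩
          N * (FGˢ ⊛ e^ l l#0 1#) n - N * (u * FGˢ n)
            ≈⟨ x[y-z]≈xy-xz _ _ _ ⟨
          N * ((FGˢ ⊛ e^ l l#0 1#) n - u * FGˢ n)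
            ≈⟨ *-congˡ (⊛-[-const] FGˢ (e^ l l#0 1#) u n) ⟨
          N * (FGˢ ⊛ (e^ l l#0 1# ⊖ const u)) n
            ≈⟨ *-congˡ (FGˢ-⊛-denominator n) ⟩
          N * ((1# - u) * (Ei∘log ⊛ e^ l l#0 x) n)
            ≈⟨ solve 3 (λ a b c → a :* (b :* c) := b :* (a :* c)) refl N (1# - u) _ ⟩
          (1# - u) * (N * (Ei∘log ⊛ e^ l l#0 x) n)
            ≈⟨ *-congˡ (Ei∘log-⊛-e^ x n) ⟨
          (1# - u) * (fromℕ n * ∑[ m < n ] (fromℕ ((n ∸ 1) C m) * 1/ℕ (suc m) * stirlingSum m * ⟨ x ⟩[ n ∸ 1 ∸ m , l ]))
            ≈⟨ *-assoc _ _ _ ⟨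
          (1# - u) * fromℕ n * ∑[ m < n ] (fromℕ ((n ∸ 1) C m) * 1/ℕ (suc m) * stirlingSum m * ⟨ x ⟩[ n ∸ 1 ∸ m , l ]) ∎
          where
          N : Carrier
          N = fromℕ (n !)

open import Defs

theorem2 : (l : ℝ) (l#0 : l #ᴿ 0ᴿ) (k : ℤ) (u : ℂ) (u#1 : u #ᶜ 1ᶜ) (x : ℝ) (n : ℕ) →
    let l′ = fromℝ l
        l′#0 = fromℝ-# l#0
        x′ = fromℝ x
        FG′ = FG l′ l′#0 k u u#1 x′
    in
    (∑[ m < suc n ] (fromℕ (n C m) * FG′ m * ⟨ 1ᶜ ⟩[ n ∸ m , l′ ])) - u * FG′ n
      ≈
    (1ᶜ - u) * fromℕ n *
      (∑[ m < n ] (fromℕ ((n ∸ 1) C m) * 1/ℕ (suc m) *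
        (∑[ j < suc m ] (⟨ 1ᶜ ⟩[ suc j , l′ ] * 1/ℕ^ (suc j) (k ℤ.- 1ℤ) * S₁ l′ l′#0 (suc m) (suc j))) *
        ⟨ x′ ⟩[ n ∸ 1 ∸ m , l′ ]))
theorem2 l l#0 k u u#1 x =
  DegenerateProperties.FG-recurrence ℂ-heytingField ℂ-charZero (fromℝ l) (fromℝ-# l#0) k u u#1 (fromℝ x)
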